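{- Let $m,n,t>0$ be integers with $t\le n$, and let $0\le b\le a\le n-t$ be integers. (i) The number of positive $(m,t)$-Schröder paths of height $n$ with exactly $a$ diagonal steps and exactly $b$ cornered diagonal steps is $$\left(\frac{t+a}{n}-\frac{m(a-b)}{mn-b-1}\right)\binom{mn-b-1}{a-b}\binom{mn+n-t-a-1}{n-t-a}.$$ (ii) The number of $m$-divisible positive $(m,t)$-Schröder paths of height $n$ with exactly $a$ diagonal steps and exactly $b$ cornered diagonal steps is $$\left(\frac{t+a}{n}-\frac{a-b}{n-b-1}\right)\binom{n-b-1}{a-b}\binom{mn+n-t-a-1}{n-t-a}.$$ Here the fractions $\frac{m(a-b)}{mn-b-1}$ and $\frac{a-b}{n-b-1}$ are read as $0$ when $a=b$ (also if the denominator vanishes).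
   Context: An $(m,t)$-Schröder path of height $n$ is a lattice path from $(0,0)$ to $(mn,n)$ using only steps $N=(0,1)$ (north), $E=(1,0)$ (east) or $D=(1,1)$ (diagonal), which starts with at least $t$ north steps and never goes below the line $x=my$ (every lattice point $(p,q)$ visited satisfies $p\le mq$). It is positive if it never touches the line $x=my$ except in $(0,0)$ and $(mn,n)$. It is $m$-divisible if every diagonal step ends at a point whose $x$-coordinate is divisible by $m$. A diagonal step is cornered if it connects $(im-1,i)$ and $(im,i+1)$ for some $i$ (with $1\le i\le n$). -}

module Defs where

open import Data.Integer.Base using (+_)
open import Data.List.Base using (List; []; _∷_; _++_; replicate; length; filter; foldl)
open import Data.List.Membership.Propositional using (_∈_)
open import Data.List.Relation.Unary.All using (All)
open import Data.List.Relation.Unary.Unique.Propositional using (Unique)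
open import Data.Nat.Base using (ℕ; zero; suc; _+_; _*_; _∸_; _≤_)
open import Data.Nat.Divisibility using (_∣_)
open import Data.Nat.Properties using (_≟_; _≤?_)
open import Data.Product.Base using (∃; ∃-syntax; _×_; _,_; proj₁; proj₂)
open import Data.Product.Properties using (≡-dec)
open import Data.Rational.Base using (ℚ; 0ℚ; _/_)
open import Data.Sum.Base using (_⊎_)
open import Function.Bundles using (_⇔_)
open import Relation.Binary.PropositionalEquality using (_≡_; refl)
open import Relation.Nullary using (Dec; _×-dec_)
open import Relation.Nullary.Decidable using (map′)

data Step : Set where
  N E D : Step

Point : Set
Point = ℕ × ℕ

origin : Point
origin = 0 , 0

advance : Point → Step → Point
advance (x , y) N = x , suc y
advance (x , y) E = suc x , y
advance (x , y) D = suc x , suc y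

-- A path is given by its step word; its starting point is supplied
-- separately.

endpoint : Point → List Step → Point
endpoint = foldl advance

-- All lattice points visited, including both ends.

visited : Point → List Step → List Point
visited p []      = p ∷ []
visited p (s ∷ w) = p ∷ visited (advance p s) w

-- The starting points of the diagonal steps, one entry for each such step.

diagonals : Point → List Step → List Point
diagonals p []      = []
diagonals p (N ∷ w) = diagonals (advance p N) w
diagonals p (E ∷ w) = diagonals (advance p E) w
diagonals p (D ∷ w) = p ∷ diagonals (advance p D) w

record IsSchröder (m t n : ℕ) (w : List Step) : Set where
  field
    ends        : endpoint origin w ≡ (m * n , n)
    startsNorth : ∃[ v ] w ≡ replicate t N ++ v
    neverBelow  : All (λ (p , q) → p ≤ m * q) (visited origin w)

-- Only lattice points need to be tested: if a step of a path staying weakly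
-- above x = m y meets that line strictly between its ends, the step lies on
-- the line and so both its ends do too.  The single step D from (0,0) to
-- (1,1), whose ends are both exempt, is not a Schröder path when t > 0.

Positive : (m n : ℕ) → List Step → Set
Positive m n w =
  All (λ (p , q) → p ≡ m * q → (p , q) ≡ origin ⊎ (p , q) ≡ (m * n , n))
      (visited origin w)

Divisible : (m : ℕ) → List Step → Set
Divisible m w = All (λ p → m ∣ proj₁ (advance p D)) (diagonals origin w)

-- Cornered m n p says that the diagonal step starting at p is cornered.
-- The equation for its end makes the truncation in i * m ∸ 1 harmless.

Cornered : (m n : ℕ) → Point → Set
Cornered m n p =
  ∃[ i ] (1 ≤ i × i ≤ n) × p ≡ (i * m ∸ 1 , i) × advance p D ≡ (i * m , suc i)

cornered? : ∀ m n p → Dec (Cornered m n p)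
cornered? m n p@(_ , y) =
  map′ (y ,_) (λ { (_ , h@(_ , refl , _)) → h })
    ((1 ≤? y ×-dec y ≤? n)
      ×-dec ≡-dec _≟_ _≟_ p (y * m ∸ 1 , y)
      ×-dec ≡-dec _≟_ _≟_ (advance p D) (y * m , suc y))

#diagonal : List Step → ℕ
#diagonal w = length (diagonals origin w)

#cornered : (m n : ℕ) → List Step → ℕ
#cornered m n w = length (filter (cornered? m n) (diagonals origin w))

record PositivePath (m t n a b : ℕ) (w : List Step) : Set where
  field
    schröder  : IsSchröder m t n w
    positive  : Positive m n w
    diagonal  : #diagonal w ≡ a
    cornered  : #cornered m n w ≡ b

DivisiblePositivePath : (m t n a b : ℕ) → List Step → Set
DivisiblePositivePath m t n a b w = PositivePath m t n a b w × Divisible m w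

-- HasCardinality P k: exactly k elements satisfy P.

HasCardinality : {A : Set} → (A → Set) → ℕ → Set
HasCardinality P k =
  ∃[ xs ] Unique xs × (∀ x → x ∈ xs ⇔ P x) × length xs ≡ k

fromℕ : ℕ → ℚ
fromℕ k = + k / 1

-- The quotient p / q, read as 0 when q = 0.

frac : ℕ → ℕ → ℚ
frac p zero      = 0ℚ
frac p q@(suc _) = + p / q

{-# OPTIONS --safe #-}

-- Let the level of a point (x , y) be m y - x.  A path is then a walk that
-- first reaches level 0 at its end, and a diagonal is cornered exactly when it
-- starts at level 1.  Say that p of any m consecutive levels admit diagonals
-- (level 1 among them): p = m in part (i), p = 1 in part (ii).  With X columns,
-- i north, k non-cornered and b cornered diagonal steps still to come, and Z + b
-- columns before the last in which a diagonal may start, the number of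
-- completions of a path is
--   α C(Z , k) - p α C(Z - 1 , k - 1) - m α⁻ C(Z , k),
-- where α and α⁻ count the multisets of size i on X elements and of size i - 1
-- on X + 1 elements.  This is verified by recursion on the first step: each
-- product satisfies the recursion by Pascal's rule, also at level 1, where a
-- cornered step takes over the terms belonging to level 0.

module Submission where

open import Defs
open import Data.Empty using (⊥)
import Data.Integer.Base as ℤ
import Data.Integer.Properties as ℤ
open import Data.List.Base using (List; []; _∷_; _++_; map; length; replicate; filter)
open import Data.List.Membership.Propositional.Properties using (∈-map⁺; ∈-map⁻; ∈-++⁺ˡ; ∈-++⁺ʳ; ∈-++⁻)
open import Data.List.Properties using (length-map; length-++; ∷-injectiveʳ; ++-cancelˡ; filter-accept; filter-reject)
open import Data.List.Relation.Unary.All using (All; []; _∷_; universal)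
open import Data.List.Relation.Unary.AllPairs using ([]; _∷_)
open import Data.List.Relation.Unary.Any using (here)
import Data.List.Relation.Unary.Unique.Propositional.Properties as Unique
open import Data.Nat.Base
open import Data.Nat.Combinatorics using (_C_; nCk+nC[k+1]≡[n+1]C[k+1]; k>n⇒nCk≡0)
open import Data.Nat.Divisibility using (_∣_; divides; _∣?_; ∣m+n∣m⇒∣n; m∣m*n; n∣m*n)
open import Data.Nat.DivMod using (m≡m%n+[m/n]*n; m%n<n; m<n⇒m/n≡0; m*n/n≡m; n/n≡1; 0/n≡0; +-distrib-/-∣ˡ; +-distrib-/-∣ʳ)
open import Data.Nat.Properties
open import Data.Nat.Tactic.RingSolver using (solve-∀)
open import Data.Product.Base using (_×_; _,_; ∃-syntax; proj₁; proj₂)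
import Data.Rational.Base as ℚ
import Data.Rational.Properties as ℚ
open import Data.Rational.Unnormalised.Base using (mkℚᵘ; *≡*)
import Data.Rational.Unnormalised.Properties as ℚᵘ
open import Data.Sum.Base using (_⊎_; inj₁; inj₂; [_,_]′)
open import Data.Unit.Base using (⊤; tt)
open import Function.Base using (_∘_; id)
open import Function.Bundles using (_⇔_; mk⇔; Equivalence)
open import Function.Definitions using (Injective)
open import Relation.Binary.PropositionalEquality
open import Relation.Nullary using (¬_; yes; no; contradiction)
open import Relation.Unary using (Decidable)

-- Binomial and multiset coefficients

nC0≡1 : ∀ n → n C 0 ≡ 1
nC0≡1 zero    = refl
nC0≡1 (suc n) = refl

-- Induction on `n`: Pascal's rule splits the coefficient, and writing k + 2 as 1 + (k + 1) on the
-- first summand only makes both summands instances of the induction hypothesis.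
absorption : ∀ n k → suc k * (suc n C suc k) ≡ suc n * (n C k)
absorption zero zero = refl
absorption zero (suc k) = trans
  (cong (suc (suc k) *_) (k>n⇒nCk≡0 {1} {suc (suc k)} (s<s z<s)))
  (trans (*-zeroʳ (suc (suc k))) (sym (cong (1 *_) (k>n⇒nCk≡0 {0} {suc k} z<s))))
absorption (suc n) zero = trans (*-identityˡ _) (trans (sym (nCk+nC[k+1]≡[n+1]C[k+1] (suc n) 0))
  (trans (cong₂ _+_ (nC0≡1 (suc n)) (trans (sym (*-identityˡ _)) (absorption n 0)))
   (cong₂ (λ u v → u + suc n * v) (sym (nC0≡1 (suc n))) (trans (nC0≡1 n) (sym (nC0≡1 (suc n)))))))
absorption (suc n) (suc k) = begin
  suc (suc k) * (suc (suc n) C suc (suc k))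
    ≡⟨ cong (suc (suc k) *_) (nCk+nC[k+1]≡[n+1]C[k+1] (suc n) (suc k)) ⟨
  suc (suc k) * ((suc n C suc k) + (suc n C suc (suc k)))
    ≡⟨ split k (suc n C suc k) _ ⟩
  suc n C suc k + suc k * (suc n C suc k) + suc (suc k) * (suc n C suc (suc k))
    ≡⟨ cong₂ (λ u v → suc n C suc k + u + v) (absorption n k) (absorption n (suc k)) ⟩
  suc n C suc k + suc n * (n C k) + suc n * (n C suc k)
    ≡⟨ join (suc n) (suc n C suc k) _ _ ⟩
  suc n C suc k + suc n * (n C k + n C suc k)
    ≡⟨ cong (λ u → suc n C suc k + suc n * u) (nCk+nC[k+1]≡[n+1]C[k+1] n k) ⟩
  suc (suc n) * (suc n C suc k) ∎
  where
  open ≡-Reasoning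
  split : ∀ k u v → suc (suc k) * (u + v) ≡ u + suc k * u + suc (suc k) * v
  split = solve-∀
  join : ∀ n u v w → u + n * v + n * w ≡ u + n * (v + w)
  join = solve-∀

-- Shift of a sequence extended by 0, so that Pascal's rule holds at index 0 as well.
prev : (ℕ → ℕ) → ℕ → ℕ
prev f zero    = 0
prev f (suc i) = f i

pascal : ∀ n k → suc n C k ≡ n C k + prev (n C_) k
pascal n zero    = trans (nC0≡1 (suc n)) (sym (trans (+-identityʳ _) (nC0≡1 n)))
pascal n (suc k) = trans (sym (nCk+nC[k+1]≡[n+1]C[k+1] n k)) (+-comm (n C k) _)

-- Z C⁻ k is C(Z - 1, k - 1), with value 0 when Z or k vanishes.
infix 6.5 _C⁻_
_C⁻_ : ℕ → ℕ → ℕ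
zero  C⁻ k = 0
suc n C⁻ k = prev (n C_) k

-- The rule has to start at Z = 2: `1 C⁻ 1` is 1, but both terms with Z = 0 vanish by convention.
C⁻-pascal : ∀ n k → suc (suc n) C⁻ k ≡ suc n C⁻ k + prev (suc n C⁻_) k
C⁻-pascal n zero    = refl
C⁻-pascal n (suc k) = pascal n k

C⁻-absorption : ∀ n k → n * (n C⁻ k) ≡ k * (n C k)
C⁻-absorption zero zero = refl
C⁻-absorption zero (suc k) = sym (trans
  (cong (suc k *_) (k>n⇒nCk≡0 {0} {suc k} z<s)) (*-zeroʳ (suc k)))
C⁻-absorption (suc n) zero = *-zeroʳ (suc n)
C⁻-absorption (suc n) (suc k) = sym (absorption n k)

-- The number of multisets of size i drawn from X elements.
infix 6.5 _M_
_M_ : ℕ → ℕ → ℕ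
X M i = (X + i ∸ 1) C i

-- A multiset either avoids the additional element or contains a copy of it that can be removed.
M-pascal : ∀ X i → suc X M i ≡ X M i + prev (suc X M_) i
M-pascal X zero    = trans (nC0≡1 (X + 0)) (sym (trans (+-identityʳ _) (nC0≡1 (X + 0 ∸ 1))))
M-pascal X (suc i) rewrite +-suc X i = pascal (X + i) (suc i)

M⁻-pascal : ∀ X i → prev (suc (suc X) M_) i ≡ prev (suc X M_) i + prev (prev (suc (suc X) M_)) i
M⁻-pascal X zero    = refl
M⁻-pascal X (suc i) = M-pascal (suc X) i

-- Choose one of the i entries of a multiset: its value is one of `X` elements, and the other i - 1
-- entries form a multiset in which this value occurs in two kinds, before and after the chosen
-- copy. In the formal proof, adding `suc i * s` turns the claim into `absorption` combined with
-- Pascal's rule.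
M-absorption : ∀ X i → X * prev (suc X M_) i ≡ i * (X M i)
M-absorption X zero = *-zeroʳ X
M-absorption zero (suc i) = sym (trans
  (cong (suc i *_) (k>n⇒nCk≡0 (n<1+n i))) (*-zeroʳ (suc i)))
M-absorption (suc X) (suc i) = begin
  suc X * ((suc X + i) C i)  ≡⟨ +-cancelˡ-≡ (suc i * ((suc X + i) C i)) _ _ (begin
    suc i * s + suc X * s    ≡⟨ lhs i X s ⟩
    suc (suc X + i) * s      ≡⟨ absorption (suc X + i) i ⟨
    suc i * (suc (suc X + i) C suc i) ≡⟨ cong (suc i *_) (pascal (suc X + i) (suc i)) ⟩
    suc i * ((suc X + i) C suc i + s) ≡⟨ rhs (suc i) ((suc X + i) C suc i) s ⟩
    suc i * s + suc i * ((suc X + i) C suc i) ∎) ⟩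
  suc i * ((suc X + i) C suc i)  ≡⟨ cong (λ u → suc i * (u C suc i)) (sym (+-suc X i)) ⟩
  suc i * ((X + suc i) C suc i) ∎
  where
  open ≡-Reasoning
  s = (suc X + i) C i
  lhs : ∀ i X s → suc i * s + suc X * s ≡ suc (suc X + i) * s
  lhs = solve-∀
  rhs : ∀ u v s → u * (v + s) ≡ u * s + u * v
  rhs = solve-∀

-- The counting formula without subtraction, and its recursion

module Balance (m p : ℕ) where

  -- c = α β - p α β⁻ - m α⁻ β, with both sides moved so that no subtraction
  -- occurs; it is linear in (α , α⁻) and in (β , β⁻).
  record Balanced (c α α⁻ β β⁻ : ℕ) : Set where
    constructor balanced
    field balance : c + (p * (α * β⁻) + m * (α⁻ * β)) ≡ α * β

  Count : (c X Z i k : ℕ) → Set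
  Count c X Z i k = Balanced c (X M i) (prev (suc X M_) i) (Z C k) (Z C⁻ k)

  balanced-0ˡ : ∀ β β⁻ → Balanced 0 0 0 β β⁻
  balanced-0ˡ β β⁻ = balanced (cong₂ _+_ (*-zeroʳ p) (*-zeroʳ m))

  balanced-+ˡ : ∀ {c d α α⁻ α′ α′⁻ β β⁻} → Balanced c α α⁻ β β⁻ → Balanced d α′ α′⁻ β β⁻ →
                Balanced (c + d) (α + α′) (α⁻ + α′⁻) β β⁻
  balanced-+ˡ {c} {d} {α} {α⁻} {α′} {α′⁻} {β} {β⁻} (balanced h) (balanced h′) =
    balanced (trans (regroup m p c d α α⁻ α′ α′⁻ β β⁻) (trans (cong₂ _+_ h h′) (sym (*-distribʳ-+ β α α′))))
    where
    regroup : ∀ m p c d α α⁻ α′ α′⁻ β β⁻ →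
      c + d + (p * ((α + α′) * β⁻) + m * ((α⁻ + α′⁻) * β)) ≡
      (c + (p * (α * β⁻) + m * (α⁻ * β))) + (d + (p * (α′ * β⁻) + m * (α′⁻ * β)))
    regroup = solve-∀

  balanced-+ʳ : ∀ {c d α α⁻ β β⁻ β′ β′⁻} → Balanced c α α⁻ β β⁻ → Balanced d α α⁻ β′ β′⁻ →
                Balanced (c + d) α α⁻ (β + β′) (β⁻ + β′⁻)
  balanced-+ʳ {c} {d} {α} {α⁻} {β} {β⁻} {β′} {β′⁻} (balanced h) (balanced h′) =
    balanced (trans (regroup m p c d α α⁻ β β⁻ β′ β′⁻) (trans (cong₂ _+_ h h′) (sym (*-distribˡ-+ α β β′))))
    where
    regroup : ∀ m p c d α α⁻ β β⁻ β′ β′⁻ →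
      c + d + (p * (α * (β⁻ + β′⁻)) + m * (α⁻ * (β + β′))) ≡
      (c + (p * (α * β⁻) + m * (α⁻ * β))) + (d + (p * (α * β′⁻) + m * (α⁻ * β′)))
    regroup = solve-∀

  -- Pascal's rule in the multiset factor: `d` stands for the completions that begin with N, `c` for
  -- all others.
  count-north : ∀ {c d X Z i k} → Count c X Z i k →
    Balanced d (prev (suc X M_) i) (prev (prev (suc (suc X) M_)) i) (Z C k) (Z C⁻ k) →
    Count (c + d) (suc X) Z i k
  count-north {X = X} {Z} {i} {k} h h′
    rewrite M-pascal X i | M⁻-pascal X i = balanced-+ˡ h h′

  -- Pascal's rule in the binomial factor: `c` stands for the completions that begin with E, `d` for
  -- those that begin with D.
  count-diagonal : ∀ {c d X Z i k} → Count c X (suc Z) i k →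
    Balanced d (X M i) (prev (suc X M_) i) (prev (suc Z C_) k) (prev (suc Z C⁻_) k) →
    Count (c + d) X (suc (suc Z)) i k
  count-diagonal {X = X} {Z} {i} {k} h h′
    rewrite pascal (suc Z) k | C⁻-pascal Z k = balanced-+ʳ h h′

  count-zero : Count 1 0 0 0 0
  count-zero = balanced (cong suc (cong₂ _+_ (*-zeroʳ p) (*-zeroʳ m)))

  -- At level 0 the two subtracted terms are the fractions k / (i + k) and
  -- i / (i + k) of the product, so that they exhaust it.
  count-line : ∀ i k .{{_ : NonZero (i + k)}} → Count 0 (m * (i + k)) (p * (i + k)) i k
  count-line i k = balanced (*-cancelˡ-≡ _ _ (i + k) (begin
    (i + k) * (p * (α * β⁻) + m * (α⁻ * β))  ≡⟨ shuffle m p (i + k) α α⁻ β β⁻ ⟩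
    α * (Z * β⁻) + (X * α⁻) * β              ≡⟨ cong₂ (λ u v → α * u + v * β) (C⁻-absorption Z k) (M-absorption X i) ⟩
    α * (k * β) + (i * α) * β                ≡⟨ collect i k α β ⟩
    (i + k) * (α * β)                        ∎))
    where
    open ≡-Reasoning
    X = m * (i + k)
    Z = p * (i + k)
    α = X M i
    α⁻ = prev (suc X M_) i
    β = Z C k
    β⁻ = Z C⁻ k
    shuffle : ∀ m p s α α⁻ β β⁻ → s * (p * (α * β⁻) + m * (α⁻ * β)) ≡ α * (p * s * β⁻) + (m * s * α⁻) * β
    shuffle = solve-∀
    collect : ∀ i k α β → α * (k * β) + (i * α) * β ≡ (i + k) * (α * β)
    collect = solve-∀

-- Cardinalities

module _ {A : Set} where

  cardinality-⇔ : {P Q : A → Set} {k : ℕ} → (∀ x → P x ⇔ Q x) →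
                  HasCardinality P k → HasCardinality Q k
  cardinality-⇔ P⇔Q (xs , unique , ∈⇔P , size) = xs , unique ,
    (λ x → mk⇔ (Equivalence.to (P⇔Q x) ∘ Equivalence.to (∈⇔P x))
               (Equivalence.from (∈⇔P x) ∘ Equivalence.from (P⇔Q x))) , size

  cardinality-∅ : {P : A → Set} → (∀ x → ¬ P x) → HasCardinality P 0
  cardinality-∅ ¬P = [] , [] , (λ x → mk⇔ (λ ()) (λ Px → contradiction Px (¬P x))) , refl

  cardinality-singleton : {P : A → Set} (x : A) → P x → (∀ y → P y → y ≡ x) → HasCardinality P 1
  cardinality-singleton {P} x Px unique = x ∷ [] , ([] ∷ []) ,
    (λ y → mk⇔ (λ { (here refl) → Px }) (here ∘ unique y)) , refl

  cardinality-⊎ : {P Q : A → Set} {k l : ℕ} → (∀ x → P x → Q x → ⊥) →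
                  HasCardinality P k → HasCardinality Q l →
                  HasCardinality (λ x → P x ⊎ Q x) (k + l)
  cardinality-⊎ disjoint (xs , uxs , ∈⇔P , refl) (ys , uys , ∈⇔Q , refl) =
    xs ++ ys ,
    Unique.++⁺ uxs uys (λ { {v} (v∈xs , v∈ys) →
      disjoint v (Equivalence.to (∈⇔P v) v∈xs) (Equivalence.to (∈⇔Q v) v∈ys) }) ,
    (λ v → mk⇔
      ([ inj₁ ∘ Equivalence.to (∈⇔P v) , inj₂ ∘ Equivalence.to (∈⇔Q v) ]′ ∘ ∈-++⁻ xs)
      [ ∈-++⁺ˡ ∘ Equivalence.from (∈⇔P v) , ∈-++⁺ʳ xs ∘ Equivalence.from (∈⇔Q v) ]′) ,
    length-++ xs

  cardinality-image : {B : Set} {P : A → Set} {k : ℕ} (f : A → B) → Injective _≡_ _≡_ f →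
                      HasCardinality P k → HasCardinality (λ y → ∃[ x ] P x × y ≡ f x) k
  cardinality-image f injective (xs , uxs , ∈⇔P , size) =
    map f xs , Unique.map⁺ injective uxs ,
    (λ y → mk⇔
      (λ y∈ → let x , x∈ , y≡fx = ∈-map⁻ f y∈ in x , Equivalence.to (∈⇔P x) x∈ , y≡fx)
      (λ { (x , Px , refl) → ∈-map⁺ f (Equivalence.from (∈⇔P x) Px) })) ,
    trans (length-map f xs) size

cardinality-by-head : {P : List Step → Set} {c d e : ℕ} → ¬ P [] →
  HasCardinality (P ∘ (E ∷_)) c → HasCardinality (P ∘ (D ∷_)) d → HasCardinality (P ∘ (N ∷_)) e →
  HasCardinality P (c + d + e)
cardinality-by-head {P} ¬P[] east diag north = cardinality-⇔ (λ w → mk⇔ (to w) (from w))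
  (cardinality-⊎ (λ { _ (inj₁ (_ , _ , refl)) (_ , _ , ()) ; _ (inj₂ (_ , _ , refl)) (_ , _ , ()) })
    (cardinality-⊎ (λ { _ (_ , _ , refl) (_ , _ , ()) })
      (cardinality-image (E ∷_) ∷-injectiveʳ east) (cardinality-image (D ∷_) ∷-injectiveʳ diag))
    (cardinality-image (N ∷_) ∷-injectiveʳ north))
  where
  Starting : Step → List Step → Set
  Starting s w = ∃[ v ] P (s ∷ v) × w ≡ s ∷ v
  to : ∀ w → (Starting E w ⊎ Starting D w) ⊎ Starting N w → P w
  to _ (inj₁ (inj₁ (_ , h , refl))) = h
  to _ (inj₁ (inj₂ (_ , h , refl))) = h
  to _ (inj₂ (_ , h , refl))        = h
  from : ∀ w → P w → (Starting E w ⊎ Starting D w) ⊎ Starting N w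
  from []      h = contradiction h ¬P[]
  from (E ∷ w) h = inj₁ (inj₁ (w , h , refl))
  from (D ∷ w) h = inj₁ (inj₂ (w , h , refl))
  from (N ∷ w) h = inj₂ (w , h , refl)

-- Walk m Ok d i k b w: the word w leads from level d to its first arrival at
-- level 0, with i north, k non-cornered diagonal and b cornered diagonal
-- steps; non-cornered diagonals start only at levels suc e with Ok e.
data Walk (m : ℕ) (Ok : ℕ → Set) : ℕ → ℕ → ℕ → ℕ → List Step → Set where
  done   : Walk m Ok 0 0 0 0 []
  east   : ∀ {e i k b w} → Walk m Ok e i k b w → Walk m Ok (suc e) i k b (E ∷ w)
  north  : ∀ {e i k b w} → Walk m Ok (m + suc e) i k b w → Walk m Ok (suc e) (suc i) k b (N ∷ w)
  corner : ∀ {i k b w} → Walk m Ok m i k b w → Walk m Ok 1 i k (suc b) (D ∷ w)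
  diag   : ∀ {e i k b w} → Ok (suc e) → Walk m Ok (m + suc e) i k b w →
           Walk m Ok (suc (suc e)) i (suc k) b (D ∷ w)

-- φ e counts the levels 1 < d ≤ suc e at which diagonals may start; there are
-- p such levels in each period m.
record Periodic (m p : ℕ) (Ok : ℕ → Set) (φ : ℕ → ℕ) : Set where
  field
    ok?      : Decidable Ok
    φ-ok     : ∀ {e} → Ok (suc e) → φ (suc e) ≡ suc (φ e)
    φ-¬ok    : ∀ {e} → ¬ Ok (suc e) → φ (suc e) ≡ φ e
    φ-zero   : φ 0 ≡ 0
    φ-pred   : φ (pred m) ≡ pred p
    φ-period : ∀ e → φ (m + e) ≡ p + φ e

-- Counting walks by recursion on the first step

module Counting (m′ p′ : ℕ) {Ok : ℕ → Set} {φ : ℕ → ℕ}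
                (periodic : Periodic (suc m′) (suc p′) Ok φ) where

  open Periodic periodic

  m p : ℕ
  m = suc m′
  p = suc p′

  open Balance m p public

  -- At level suc e the walk has suc (columns e i k b) columns left.
  columns : (e i k b : ℕ) → ℕ
  columns e i k b = e + m * (i + k + b)

  -- This is φ e + p (i + k + b) - b: each N or D to come contributes one period of p admissible
  -- levels, and each cornered diagonal occupies one of them.
  slots : (e i k b : ℕ) → ℕ
  slots e i k b = φ e + p * (i + k) + p′ * b

  columns-north : ∀ e i k b → columns e (suc i) k b ≡ columns (m′ + suc e) i k b
  columns-north e i k b = identity m′ e (i + k + b)
    where
    identity : ∀ m′ e j → e + suc m′ * suc j ≡ m′ + suc e + suc m′ * j
    identity = solve-∀

  columns-diag : ∀ e i k b → columns (suc e) i (suc k) b ≡ suc (columns (m′ + suc e) i k b)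
  columns-diag e i k b = identity m′ e i k b
    where
    identity : ∀ m′ e i k b → suc e + suc m′ * (i + suc k + b) ≡ suc (m′ + suc e + suc m′ * (i + k + b))
    identity = solve-∀

  columns-corner : ∀ i k b → columns 0 i k (suc b) ≡ suc (columns m′ i k b)
  columns-corner i k b = identity m′ i k b
    where
    identity : ∀ m′ i k b → suc m′ * (i + k + suc b) ≡ suc (m′ + suc m′ * (i + k + b))
    identity = solve-∀

  φ-period′ : ∀ e → φ (m′ + suc e) ≡ p + φ e
  φ-period′ e = trans (cong φ (+-suc m′ e)) (φ-period e)

  slots-north : ∀ e i k b → slots e (suc i) k b ≡ slots (m′ + suc e) i k b
  slots-north e i k b = trans (identity p′ (φ e) (i + k) (p′ * b))
      (cong (λ u → u + p * (i + k) + p′ * b) (sym (φ-period′ e)))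
    where
    identity : ∀ p′ f j c → f + suc p′ * suc j + c ≡ suc p′ + f + suc p′ * j + c
    identity = solve-∀

  -- From level e + 2, a D followed by k further non-cornered diagonals leaves the same columns and
  -- slots as an E followed by k + 1 of them. The two counts thus differ only in k, as Pascal's rule
  -- requires.
  slots-diag : ∀ e i k b → φ e + p * (i + suc k) + p′ * b ≡ slots (m′ + suc e) i k b
  slots-diag e i k b = trans (identity p′ (φ e) i k (p′ * b))
      (cong (λ u → u + p * (i + k) + p′ * b) (sym (φ-period′ e)))
    where
    identity : ∀ p′ f i k c → f + suc p′ * (i + suc k) + c ≡ suc p′ + f + suc p′ * (i + k) + c
    identity = solve-∀

  -- The step lands on level m, and the `p′` admissible levels from 2 to m are those that `slots`
  -- had reserved for it.
  slots-corner : ∀ i k b → slots 0 i k (suc b) ≡ slots m′ i k b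
  slots-corner i k b = trans (cong (λ u → u + p * (i + k) + p′ * suc b) φ-zero)
    (trans (identity p′ (i + k) b) (cong (λ u → u + p * (i + k) + p′ * b) (sym φ-pred)))
    where
    identity : ∀ p′ j b → 0 + suc p′ * j + p′ * suc b ≡ p′ + suc p′ * j + p′ * b
    identity = solve-∀

  -- Supplies the bound on Z that `count-diagonal` inherits from `C⁻-pascal`; the diagonal still to
  -- come guarantees it.
  slots-diag-positive : ∀ e i k b → ∃[ z ] φ e + p * (i + suc k) + p′ * b ≡ suc z
  slots-diag-positive e i k b = _ , identity p′ (φ e) i k (p′ * b)
    where
    identity : ∀ p′ f i k c → f + suc p′ * (i + suc k) + c ≡ suc (p′ + f + suc p′ * (i + k) + c)
    identity = solve-∀

  W : ℕ → ℕ → ℕ → ℕ → List Step → Set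
  W = Walk m Ok

  -- For k = 0 the binomial factors do not depend on Z. This replaces `count-diagonal` where Z may
  -- be 0.
  count-no-diagonal : ∀ {c X Z i} → Count c X Z i 0 → Count c X (suc Z) i 0
  count-no-diagonal {c} {X} {Z} {i} = subst₂ (Balanced c (X M i) (prev (suc X M_) i))
    (trans (nC0≡1 Z) (sym (nC0≡1 (suc Z)))) (C⁻0≡0 Z)
    where
    C⁻0≡0 : ∀ Z → Z C⁻ 0 ≡ 0
    C⁻0≡0 zero    = refl
    C⁻0≡0 (suc Z) = refl

  mutual

    -- `X` and `Z` are separate arguments tied by equations, so that the recursion is structural: E
    -- and D decrease `X`, while N keeps `X` and decreases `i`.
    count : ∀ X Z e i k b → X ≡ columns e i k b → Z ≡ slots e i k b →
            ∃[ c ] HasCardinality (W (suc e) i k b) c × Count c (suc X) Z i k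
    count X Z e i k b X≡ Z≡ =
      let c , d , cards , bal = eastOrDiag X Z e i k b X≡ Z≡
          f , card , bal′ = startNorth X Z e i k b X≡ Z≡
      in c + d + f , cardinality-by-head (λ ()) (proj₁ cards) (proj₂ cards) card ,
         count-north {X = X} {Z} {i} {k} bal bal′

    startNorth : ∀ X Z e i k b → X ≡ columns e i k b → Z ≡ slots e i k b →
      ∃[ f ] HasCardinality (W (suc e) i k b ∘ (N ∷_)) f ×
             Balanced f (prev (suc X M_) i) (prev (prev (suc (suc X) M_)) i) (Z C k) (Z C⁻ k)
    startNorth X Z e zero    k b X≡ Z≡ = 0 , cardinality-∅ (λ _ ()) , balanced-0ˡ _ _
    startNorth X Z e (suc i) k b X≡ Z≡ =
      let f , card , bal = count X Z (m′ + suc e) i k b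
                             (trans X≡ (columns-north e i k b)) (trans Z≡ (slots-north e i k b))
      in f , cardinality-⇔ (λ w → mk⇔ north (λ { (north h) → h })) card , bal

    eastOrDiag : ∀ X Z e i k b → X ≡ columns e i k b → Z ≡ slots e i k b →
      ∃[ c ] ∃[ d ] (HasCardinality (W (suc e) i k b ∘ (E ∷_)) c ×
                     HasCardinality (W (suc e) i k b ∘ (D ∷_)) d) × Count (c + d) X Z i k
    eastOrDiag X Z zero zero zero zero X≡ Z≡ = 1 , 0 ,
      (cardinality-singleton [] (east done) (λ { _ (east done) → refl }) , cardinality-∅ (λ { _ () })) ,
      subst₂ (λ X Z → Count 1 X Z 0 0)
        (sym (trans X≡ (*-zeroʳ m)))
        (sym (trans Z≡ (cong₂ _+_ (cong₂ _+_ φ-zero (*-zeroʳ p)) (*-zeroʳ p′))))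
        count-zero
    eastOrDiag X Z zero i@(suc _) k zero X≡ Z≡ = onLine X Z i k X≡ Z≡
    eastOrDiag X Z zero zero k@(suc _) zero X≡ Z≡ = onLine X Z zero k X≡ Z≡
    eastOrDiag zero Z zero i k (suc b) X≡ Z≡ = contradiction (trans X≡ (columns-corner i k b)) λ ()
    -- An E would reach level 0 with a cornered diagonal still due. The D uses one column and keeps
    -- Z, so the count after it is already the required one.
    eastOrDiag (suc X) Z zero i k (suc b) X≡ Z≡ =
      let d , card , bal = count X Z m′ i k b
                             (suc-injective (trans X≡ (columns-corner i k b))) (trans Z≡ (slots-corner i k b))
      in 0 , d , (cardinality-∅ (λ { _ (east ()) }) ,
                  cardinality-⇔ (λ w → mk⇔ corner (λ { (corner h) → h })) card) , bal
    eastOrDiag (suc X) Z (suc e) i k b X≡ Z≡ with ok? (suc e)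
    ... | no ¬ok =
      let c , card , bal = count X Z e i k b (suc-injective X≡)
                             (trans Z≡ (cong (λ u → u + p * (i + k) + p′ * b) (φ-¬ok ¬ok)))
      in c , 0 , (cardinality-⇔ (λ w → mk⇔ east (λ { (east h) → h })) card ,
                  cardinality-∅ (λ { _ (diag ok _) → ¬ok ok })) ,
         subst (λ u → Count u (suc X) Z i k) (sym (+-identityʳ c)) bal
    ... | yes ok =
      let Z≡′ = trans Z≡ (cong (λ u → u + p * (i + k) + p′ * b) (φ-ok ok))
          c , card , bal = count X (slots e i k b) e i k b (suc-injective X≡) refl
          d , card′ , bal′ = startDiag X e i k b ok (suc-injective X≡) bal
      in c , d , (cardinality-⇔ (λ w → mk⇔ east (λ { (east h) → h })) card , card′) ,
         subst (λ Z → Count (c + d) (suc X) Z i k) (sym Z≡′) bal′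

    startDiag : ∀ {c} X e i k b → Ok (suc e) → X ≡ columns e i k b → Count c (suc X) (slots e i k b) i k →
      ∃[ d ] HasCardinality (W (suc (suc e)) i k b ∘ (D ∷_)) d ×
             Count (c + d) (suc X) (suc (slots e i k b)) i k
    startDiag {c} X e i zero b ok X≡ bal = 0 , cardinality-∅ (λ { _ () }) ,
      count-no-diagonal {X = suc X} {slots e i 0 b} {i} (subst (λ u → Count u (suc X) (slots e i 0 b) i 0) (sym (+-identityʳ c)) bal)
    startDiag {c} X e i (suc k) b ok X≡ bal
      with slots e i (suc k) b in Z≡ | slots-diag-positive e i k b
    ... | _ | Z , refl =
      let d , card , bal′ = count X (suc Z) (m′ + suc e) i k b
                              (trans X≡ (suc-injective (columns-diag e i k b)))
                              (trans (sym Z≡) (slots-diag e i k b))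
      in d , cardinality-⇔ (λ w → mk⇔ (diag ok) (λ { (diag _ h) → h })) card ,
         count-diagonal {X = suc X} {Z} {i} {suc k} bal bal′

    -- At level 1 with no cornered diagonal due, D is impossible, and E would end the walk with i +
    -- k > 0 steps still due. Both counts are 0, which is the value found in `count-line`.
    onLine : ∀ X Z i k .{{_ : NonZero (i + k)}} → X ≡ columns 0 i k 0 → Z ≡ slots 0 i k 0 →
      ∃[ c ] ∃[ d ] (HasCardinality (W 1 i k 0 ∘ (E ∷_)) c ×
                     HasCardinality (W 1 i k 0 ∘ (D ∷_)) d) × Count (c + d) X Z i k
    onLine X Z i k X≡ Z≡ = 0 , 0 ,
      (cardinality-∅ (λ { _ (east done) → ≢-nonZero⁻¹ 0 refl }) , cardinality-∅ (λ { _ () })) ,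
      subst₂ (λ X Z → Count 0 X Z i k)
        (sym (trans X≡ (cong (m *_) (+-identityʳ (i + k)))))
        (sym (trans Z≡ (trans (cong₂ _+_ (cong (_+ p * (i + k)) φ-zero) (*-zeroʳ p′)) (+-identityʳ _))))
        (count-line i k)

-- Paths as walks

-- Every step raises x + y by at least 1. Hence a word that ends where it starts is empty.
endpoint-sum : ∀ p w → proj₁ p + proj₂ p + length w ≤ proj₁ (endpoint p w) + proj₂ (endpoint p w)
endpoint-sum (x , y) []      = ≤-reflexive (+-identityʳ (x + y))
endpoint-sum (x , y) (N ∷ w) = ≤-trans (≤-reflexive (identity x y (length w))) (endpoint-sum (x , suc y) w)
  where
  identity : ∀ x y l → x + y + suc l ≡ x + suc y + l
  identity = solve-∀
endpoint-sum (x , y) (E ∷ w) = ≤-trans (≤-reflexive (+-suc (x + y) (length w))) (endpoint-sum (suc x , y) w)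
endpoint-sum (x , y) (D ∷ w) =
  ≤-trans (≤-trans (n≤1+n _) (≤-reflexive (identity x y (length w)))) (endpoint-sum (suc x , suc y) w)
  where
  identity : ∀ x y l → suc (x + y + suc l) ≡ suc x + suc y + l
  identity = solve-∀

module _ {m n x y : ℕ} where

  corner-cornered : x + 1 ≡ m * y → y ≤ n → Cornered m n (x , y)
  corner-cornered x+1≡my y≤n = y , (1≤y y x+1≡my , y≤n) ,
    cong (_, y) (cong pred 1+x≡ym) , cong (_, suc y) 1+x≡ym
    where
    1+x≡ym : suc x ≡ y * m
    1+x≡ym = trans (+-comm 1 x) (trans x+1≡my (*-comm m y))
    1≤y : ∀ y → x + 1 ≡ m * y → 1 ≤ y
    1≤y zero    eq = contradiction (trans (+-comm 1 x) (trans eq (*-zeroʳ m))) λ ()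
    1≤y (suc y) eq = s≤s z≤n

  -- The end of a cornered diagonal has x-coordinate m y, which forces its start to level 1.
  higher-not-cornered : ∀ {e} → x + suc (suc e) ≡ m * y → ¬ Cornered m n (x , y)
  higher-not-cornered {e} eq (_ , _ , refl , eq′) = m≢1+m+n (suc x) (begin
    suc x           ≡⟨ cong proj₁ eq′ ⟩
    y * m           ≡⟨ *-comm y m ⟩
    m * y           ≡⟨ eq ⟨
    x + suc (suc e) ≡⟨ +-suc x (suc e) ⟩
    suc (x + suc e) ≡⟨ cong suc (+-suc x e) ⟩
    suc (suc x + e) ∎)
    where open ≡-Reasoning

module _ {m x y e : ℕ} (level : x + suc e ≡ m * y) where

  level-east : suc x + e ≡ m * y
  level-east = trans (sym (+-suc x e)) level

  level-north : x + (m + suc e) ≡ m * suc y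
  level-north = trans (identity x m (suc e)) (trans (cong (m +_) level) (sym (*-suc m y)))
    where
    identity : ∀ x m d → x + (m + d) ≡ m + (x + d)
    identity = solve-∀

  level-diag : suc x + (m + e) ≡ m * suc y
  level-diag = trans (identity x m e) level-north
    where
    identity : ∀ x m e → suc x + (m + e) ≡ x + (m + suc e)
    identity = solve-∀

level-corner : ∀ {m x y} → x + 1 ≡ m * y → suc x + m ≡ m * suc y
level-corner {m} {x} level = trans (cong (suc x +_) (sym (+-identityʳ m))) (level-diag level)

-- Translates a condition on starting points into one on levels. `Ok` is tested one below the
-- starting level: that number is m y - (x + 1), which knows the x-coordinate of the step's end
-- modulo m.
record Classifies (m : ℕ) (Allowed : Point → Set) (Ok : ℕ → Set) : Set where
  field
    at-corner : ∀ {x y} → x + 1 ≡ m * y → Allowed (x , y)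
    above     : ∀ {x y e} → x + suc (suc e) ≡ m * y → Allowed (x , y) ⇔ Ok (suc e)

module Paths (m n : ℕ) {Allowed : Point → Set} {Ok : ℕ → Set}
             (classifies : Classifies m Allowed Ok) where

  open Classifies classifies

  Below Off : Point → Set
  Below (x , y) = x ≤ m * y
  Off (x , y)   = x ≡ m * y → (x , y) ≡ origin ⊎ (x , y) ≡ (m * n , n)

  record Tail (p : Point) (w : List Step) : Set where
    constructor tail
    field
      ends    : endpoint p w ≡ (m * n , n)
      below   : All Below (visited p w)
      off     : All Off (visited p w)
      allowed : All Allowed (diagonals p w)

  HasDiagonals : (k b : ℕ) → Point → List Step → Set
  HasDiagonals k b p w =
    length (diagonals p w) ≡ k + b × length (filter (cornered? m n) (diagonals p w)) ≡ b

  hasDiagonals-corner : ∀ {k b x y} w → Cornered m n (x , y) →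
    HasDiagonals k b (suc x , suc y) w → HasDiagonals k (suc b) (x , y) (D ∷ w)
  hasDiagonals-corner {k} {b} _ cornered (h , h′) =
    trans (cong suc h) (sym (+-suc k b)) ,
    trans (cong length (filter-accept (cornered? m n) cornered)) (cong suc h′)

  hasDiagonals-diag : ∀ {k b x y} w → ¬ Cornered m n (x , y) →
    HasDiagonals k b (suc x , suc y) w → HasDiagonals (suc k) b (x , y) (D ∷ w)
  hasDiagonals-diag _ ¬cornered (h , h′) =
    cong suc h , trans (cong length (filter-reject (cornered? m n) ¬cornered)) h′

  below-level : ∀ {x y d} → x + d ≡ m * y → Below (x , y)
  below-level {x} {y} {d} level = ≤-trans (m≤m+n x d) (≤-reflexive level)

  off-level : ∀ {x y e} → x + suc e ≡ m * y → Off (x , y)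
  off-level {x} {y} {e} level x≡my =
    contradiction (trans x≡my (trans (sym level) (+-suc x e))) (m≢1+m+n x)

  -- The height equation locates the end: every N or D raises y by 1, so y = n when the walk is
  -- done, and level 0 then means x = m n.
  walk⇒tail : ∀ {d i k b w x y} → Walk m Ok d i k b w → x + d ≡ m * y → y + (i + k + b) ≡ n →
              Tail (x , y) w × HasDiagonals k b (x , y) w
  walk⇒tail {x = x} {y} done level height =
    tail end (below-level level ∷ []) ((λ _ → inj₂ end) ∷ []) [] , refl , refl
    where
    y≡n : y ≡ n
    y≡n = trans (sym (+-identityʳ y)) height
    end : (x , y) ≡ (m * n , n)
    end = cong₂ _,_ (trans (sym (+-identityʳ x)) (trans level (cong (m *_) y≡n))) y≡n
  walk⇒tail {x = x} {y} (east h) level height =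
    let tail ends below off allowed , diags = walk⇒tail h (level-east {m} {y = y} level) height
    in tail ends (below-level level ∷ below) (off-level level ∷ off) allowed , diags
  walk⇒tail {i = suc i} {k} {b} {x = x} {y} (north h) level height =
    let tail ends below off allowed , diags =
          walk⇒tail h (level-north level) (trans (sym (+-suc y (i + k + b))) height)
    in tail ends (below-level level ∷ below) (off-level level ∷ off) allowed , diags
  walk⇒tail {i = i} {k} {suc b} {D ∷ w} {x = x} {y} (corner h) level height =
    let tail ends below off allowed , diags =
          walk⇒tail h (level-corner level) (trans (identity y (i + k) b) height)
    in tail ends (below-level level ∷ below) (off-level level ∷ off) (at-corner level ∷ allowed) ,
       hasDiagonals-corner {k = k} w
         (corner-cornered level (≤-trans (m≤m+n y (i + k + suc b)) (≤-reflexive height))) diags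
    where
    identity : ∀ y j b → suc y + (j + b) ≡ y + (j + suc b)
    identity = solve-∀
  walk⇒tail {i = i} {suc k} {b} {D ∷ w} {x = x} {y} (diag ok h) level height =
    let tail ends below off allowed , diags =
          walk⇒tail h (level-diag level) (trans (identity y i k b) height)
    in tail ends (below-level level ∷ below) (off-level level ∷ off)
         (Equivalence.from (above level) ok ∷ allowed) ,
       hasDiagonals-diag {k = k} w (higher-not-cornered level) diags
    where
    identity : ∀ y i k b → suc y + (i + k + b) ≡ y + (i + suc k + b)
    identity = solve-∀

  -- The numbers of steps are read off the word. The bound on y excludes the origin, the one point
  -- of level 0 from which a positive path may continue.
  tail⇒walk : ∀ d w {x y} → 1 ≤ y → x + d ≡ m * y → Tail (x , y) w →
    ∃[ i ] ∃[ k ] ∃[ b ] Walk m Ok d i k b w × y + (i + k + b) ≡ n × HasDiagonals k b (x , y) w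
  -- Positivity makes a point of level 0 the endpoint (m n, n), and by `endpoint-sum` no further
  -- step can return to it.
  tail⇒walk zero w {x} {y} 1≤y level (tail ends below off allowed) = atEnd w ends off
    where
    final : ∀ w → All Off (visited (x , y) w) → (x , y) ≡ (m * n , n)
    final′ : Off (x , y) → (x , y) ≡ (m * n , n)
    final′ f with f (trans (sym (+-identityʳ x)) level)
    ... | inj₁ refl = contradiction 1≤y λ ()
    ... | inj₂ eq   = eq
    final []      (f ∷ _) = final′ f
    final (_ ∷ _) (f ∷ _) = final′ f
    atEnd : ∀ w → endpoint (x , y) w ≡ (m * n , n) → All Off (visited (x , y) w) →
      ∃[ i ] ∃[ k ] ∃[ b ] Walk m Ok 0 i k b w × y + (i + k + b) ≡ n × HasDiagonals k b (x , y) w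
    atEnd []        _    offs = 0 , 0 , 0 , done ,
      trans (+-identityʳ y) (cong proj₂ (final [] offs)) , refl , refl
    atEnd w@(s ∷ w′) ends offs = contradiction
      (≤-trans (endpoint-sum (x , y) w)
               (≤-reflexive (cong (λ q → proj₁ q + proj₂ q) (trans ends (sym (final w offs))))))
      (m+1+n≰m (x + y))
  tail⇒walk (suc e) [] {x} {y} 1≤y level (tail ends _ _ _) =
    contradiction (trans (cong proj₁ ends) (trans (cong (λ q → m * proj₂ q) (sym ends)) (trans (sym level) (+-suc x e))))
                  (m≢1+m+n x)
  tail⇒walk (suc e) (E ∷ w) {y = y} 1≤y level (tail ends (_ ∷ below) (_ ∷ off) allowed) =
    let i , k , b , h , height , diags =
          tail⇒walk e w 1≤y (level-east {m} {y = y} level) (tail ends below off allowed)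
    in i , k , b , east h , height , diags
  tail⇒walk (suc e) (N ∷ w) {y = y} 1≤y level (tail ends (_ ∷ below) (_ ∷ off) allowed) =
    let i , k , b , h , height , diags =
          tail⇒walk (m + suc e) w (s≤s z≤n) (level-north level) (tail ends below off allowed)
    in suc i , k , b , north h , trans (+-suc y (i + k + b)) height , diags
  tail⇒walk 1 (D ∷ w) {y = y} 1≤y level (tail ends (_ ∷ below) (_ ∷ off) (_ ∷ allowed)) =
    let i , k , b , h , height , diags =
          tail⇒walk m w (s≤s z≤n) (level-corner level) (tail ends below off allowed)
        height′ = trans (identity y (i + k) b) height
    in i , k , suc b , corner h , height′ ,
       hasDiagonals-corner {k = k} w
         (corner-cornered level (≤-trans (m≤m+n y (i + k + suc b)) (≤-reflexive height′))) diags
    where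
    identity : ∀ y j b → y + (j + suc b) ≡ suc y + (j + b)
    identity = solve-∀
  tail⇒walk (suc (suc e)) (D ∷ w) {y = y} 1≤y level (tail ends (_ ∷ below) (_ ∷ off) (ok ∷ allowed)) =
    let i , k , b , h , height , diags =
          tail⇒walk (m + suc e) w (s≤s z≤n) (level-diag level) (tail ends below off allowed)
    in i , suc k , b , diag (Equivalence.to (above level) ok) h , trans (identity y i k b) height ,
       hasDiagonals-diag {k = k} w (higher-not-cornered level) diags
    where
    identity : ∀ y i k b → y + (i + suc k + b) ≡ suc y + (i + k + b)
    identity = solve-∀

  module _ (v : List Step) where

    endpoint-norths : ∀ t q → endpoint (0 , q) (replicate t N ++ v) ≡ endpoint (0 , q + t) v
    endpoint-norths zero    q = cong (λ q → endpoint (0 , q) v) (sym (+-identityʳ q))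
    endpoint-norths (suc t) q = trans (endpoint-norths t (suc q)) (cong (λ q → endpoint (0 , q) v) (sym (+-suc q t)))

    diagonals-norths : ∀ t q → diagonals (0 , q) (replicate t N ++ v) ≡ diagonals (0 , q + t) v
    diagonals-norths zero    q = cong (λ q → diagonals (0 , q) v) (sym (+-identityʳ q))
    diagonals-norths (suc t) q = trans (diagonals-norths t (suc q)) (cong (λ q → diagonals (0 , q) v) (sym (+-suc q t)))

    visited-norths : ∀ {P : Point → Set} t q → (∀ y → P (0 , y)) →
      All P (visited (0 , q) (replicate t N ++ v)) ⇔ All P (visited (0 , q + t) v)
    visited-norths {P} zero q _ = mk⇔ (subst (λ q → All P (visited (0 , q) v)) (sym (+-identityʳ q)))
                                      (subst (λ q → All P (visited (0 , q) v)) (+-identityʳ q))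
    visited-norths {P} (suc t) q onAxis = mk⇔
      (λ { (_ ∷ h) → subst (λ q → All P (visited (0 , q) v)) (sym (+-suc q t)) (to h) })
      (λ h → onAxis q ∷ from (subst (λ q → All P (visited (0 , q) v)) (+-suc q t) h))
      where open Equivalence (visited-norths {P} t (suc q) onAxis)

  off-axis : 1 ≤ m → ∀ y → Off (0 , y)
  off-axis 1≤m zero    _  = inj₁ refl
  off-axis 1≤m (suc y) eq = contradiction (subst (1 ≤_) (sym eq) (*-mono-≤ 1≤m (s≤s (z≤n {y})))) λ ()

  AllowedPath : (t a b : ℕ) → List Step → Set
  AllowedPath t a b w = PositivePath m t n a b w × All Allowed (diagonals origin w)

  -- The t prescribed north steps lead along the axis to (0, t), which has level m t; the remaining
  -- word is the walk. As t > 0, it starts away from the origin.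
  path⇔walk : ∀ {t a i k b} → 1 ≤ m → 1 ≤ t → a ≡ k + b → t + (i + k + b) ≡ n → ∀ w →
    (∃[ v ] Walk m Ok (m * t) i k b v × w ≡ replicate t N ++ v) ⇔ AllowedPath t a b w
  path⇔walk {t} {_} {i} {k} {b} 1≤m 1≤t refl height w = mk⇔ to from
    where
    to : (∃[ v ] Walk m Ok (m * t) i k b v × w ≡ replicate t N ++ v) → AllowedPath t (k + b) b w
    to (v , walk , refl) = record
      { schröder = record
          { ends        = trans (endpoint-norths v t 0) (Tail.ends h)
          ; startsNorth = v , refl
          ; neverBelow  = Equivalence.from (visited-norths v t 0 (λ _ → z≤n)) (Tail.below h)
          }
      ; positive = Equivalence.from (visited-norths v t 0 (off-axis 1≤m)) (Tail.off h)
      ; diagonal = trans (cong length (diagonals-norths v t 0)) (proj₁ diags)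
      ; cornered = trans (cong (λ ds → length (filter (cornered? m n) ds)) (diagonals-norths v t 0)) (proj₂ diags)
      } , subst (All Allowed) (sym (diagonals-norths v t 0)) (Tail.allowed h)
      where
      h,diags = walk⇒tail walk refl height
      h = proj₁ h,diags
      diags = proj₂ h,diags
    from : AllowedPath t (k + b) b w → ∃[ v ] Walk m Ok (m * t) i k b v × w ≡ replicate t N ++ v
    from (record { schröder = record { ends = ends ; startsNorth = v , refl ; neverBelow = below }
                 ; positive = off ; diagonal = diagonal ; cornered = cornered } , allowed)
      with tail⇒walk (m * t) v 1≤t refl (tail
             (trans (sym (endpoint-norths v t 0)) ends)
             (Equivalence.to (visited-norths v t 0 (λ _ → z≤n)) below)
             (Equivalence.to (visited-norths v t 0 (off-axis 1≤m)) off)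
             (subst (All Allowed) (diagonals-norths v t 0) allowed))
    -- The numbers read off the word agree with the prescribed ones: first b by the cornered
    -- diagonals, then k by all diagonals, then i by the height.
    ... | i′ , k′ , b′ , walk , height′ , #diags , #cornered = v , subst-walk b≡ k≡ i≡ walk , refl
      where
      b≡ : b′ ≡ b
      b≡ = trans (sym #cornered)
             (trans (cong (λ ds → length (filter (cornered? m n) ds)) (sym (diagonals-norths v t 0))) cornered)
      k≡ : k′ ≡ k
      k≡ = +-cancelʳ-≡ b k′ k (trans (cong (k′ +_) (sym b≡))
             (trans (sym #diags) (trans (cong length (sym (diagonals-norths v t 0))) diagonal)))
      i≡ : i′ ≡ i
      i≡ = +-cancelʳ-≡ k i′ i (+-cancelʳ-≡ b (i′ + k) (i + k) (+-cancelˡ-≡ t _ _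
             (trans (cong₂ (λ k b → t + (i′ + k + b)) (sym k≡) (sym b≡)) (trans height′ (sym height)))))
      subst-walk : ∀ {i′ k′ b′} → b′ ≡ b → k′ ≡ k → i′ ≡ i →
                   Walk m Ok (m * t) i′ k′ b′ v → Walk m Ok (m * t) i k b v
      subst-walk refl refl refl h = h

-- Evaluation in ℚ

-- In unnormalised rationals the claim is a cross-multiplication, so no fraction has to be reduced.
frac-* : ∀ {q r} p n → suc n * q ≡ p * r → frac p (suc n) ℚ.* fromℕ r ≡ fromℕ q
frac-* {q} {r} p n eq = ℚ.toℚᵘ-injective
  (ℚᵘ.≃-trans (ℚ.toℚᵘ-homo-* (frac p (suc n)) (fromℕ r))
  (ℚᵘ.≃-trans (ℚᵘ.*-cong (ℚ.toℚᵘ-fromℚᵘ (mkℚᵘ (ℤ.+ p) n)) (ℚ.toℚᵘ-fromℚᵘ (mkℚᵘ (ℤ.+ r) 0)))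
  (ℚᵘ.≃-trans (*≡* crossed) (ℚᵘ.≃-sym (ℚ.toℚᵘ-fromℚᵘ (mkℚᵘ (ℤ.+ q) 0))))))
  where
  open ≡-Reasoning
  crossed : (ℤ.+ p ℤ.* ℤ.+ r) ℤ.* ℤ.+ 1 ≡ ℤ.+ q ℤ.* ℤ.+ (suc n * 1)
  crossed = begin
    (ℤ.+ p ℤ.* ℤ.+ r) ℤ.* ℤ.+ 1 ≡⟨ ℤ.*-identityʳ _ ⟩
    ℤ.+ p ℤ.* ℤ.+ r             ≡⟨ ℤ.pos-* p r ⟨
    ℤ.+ (p * r)                 ≡⟨ cong ℤ.+_ (trans (sym eq) (trans (*-comm (suc n) q) (cong (q *_) (sym (*-identityʳ (suc n)))))) ⟩
    ℤ.+ (q * (suc n * 1))       ≡⟨ ℤ.pos-* q (suc n * 1) ⟩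
    ℤ.+ q ℤ.* ℤ.+ (suc n * 1)   ∎

fromℕ-* : ∀ p r → fromℕ p ℚ.* fromℕ r ≡ fromℕ (p * r)
fromℕ-* p r = frac-* p 0 (*-identityˡ (p * r))

fromℕ-+ : ∀ p q → fromℕ (p + q) ≡ fromℕ p ℚ.+ fromℕ q
fromℕ-+ p q = ℚ.toℚᵘ-injective
  (ℚᵘ.≃-trans (ℚ.toℚᵘ-fromℚᵘ (mkℚᵘ (ℤ.+ (p + q)) 0))
  (ℚᵘ.≃-trans (*≡* crossed)
  (ℚᵘ.≃-sym (ℚᵘ.≃-trans (ℚ.toℚᵘ-homo-+ (fromℕ p) (fromℕ q))
    (ℚᵘ.+-cong (ℚ.toℚᵘ-fromℚᵘ (mkℚᵘ (ℤ.+ p) 0)) (ℚ.toℚᵘ-fromℚᵘ (mkℚᵘ (ℤ.+ q) 0)))))))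
  where
  crossed : ℤ.+ (p + q) ℤ.* ℤ.+ 1 ≡ (ℤ.+ p ℤ.* ℤ.+ 1 ℤ.+ ℤ.+ q ℤ.* ℤ.+ 1) ℤ.* ℤ.+ 1
  crossed = cong (ℤ._* ℤ.+ 1) (trans (ℤ.pos-+ p q)
    (sym (cong₂ ℤ._+_ (ℤ.*-identityʳ (ℤ.+ p)) (ℤ.*-identityʳ (ℤ.+ q)))))

-- For Z = 0 the default value of `frac` meets that of `C⁻`; otherwise this is absorption.
frac-C : ∀ p Z k → frac (p * k) Z ℚ.* fromℕ (Z C k) ≡ fromℕ (p * (Z C⁻ k))
frac-C p zero    k = trans (ℚ.*-zeroˡ (fromℕ (0 C k))) (cong fromℕ (sym (*-zeroʳ p)))
frac-C p (suc Z) k = frac-* (p * k) Z (begin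
  suc Z * (p * (suc Z C⁻ k))  ≡⟨ swap (suc Z) p (suc Z C⁻ k) ⟩
  p * (suc Z * (suc Z C⁻ k))  ≡⟨ cong (p *_) (C⁻-absorption (suc Z) k) ⟩
  p * (k * (suc Z C k))       ≡⟨ *-assoc p k (suc Z C k) ⟨
  p * k * (suc Z C k)         ∎)
  where
  open ≡-Reasoning
  swap : ∀ z p c → z * (p * c) ≡ p * (z * c)
  swap = solve-∀

module Evaluation (m p : ℕ) where
  open Balance m p

  -- With X = m n, `M-absorption` gives m α⁻ = (i / n) α. So the first and third terms of the
  -- balance merge into (1 - i / n) α β = (s / n) α β, and `frac-C` turns the second into the other
  -- fraction.
  count-formula : ∀ {c Z i k} s n′ → s + i ≡ suc n′ → Count c (m * suc n′) Z i k →
    fromℕ c ≡ (frac s (suc n′) ℚ.- frac (p * k) Z) ℚ.* fromℕ (Z C k) ℚ.* fromℕ (m * suc n′ M i)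
  count-formula {c} {Z} {i} {k} s n′ s+i≡n (balanced balance) = sym (begin
    (F ℚ.- G) ℚ.* fromℕ β ℚ.* fromℕ α
      ≡⟨ cong (ℚ._* fromℕ α) (ℚ.*-distribʳ-+ (fromℕ β) F (ℚ.- G)) ⟩
    (F ℚ.* fromℕ β ℚ.+ (ℚ.- G) ℚ.* fromℕ β) ℚ.* fromℕ α
      ≡⟨ cong (λ u → (F ℚ.* fromℕ β ℚ.+ u) ℚ.* fromℕ α) (trans (sym (ℚ.neg-distribˡ-* G (fromℕ β))) (cong ℚ.-_ (frac-C p Z k))) ⟩
    (F ℚ.* fromℕ β ℚ.+ ℚ.- fromℕ (p * β⁻)) ℚ.* fromℕ α
      ≡⟨ ℚ.*-distribʳ-+ (fromℕ α) (F ℚ.* fromℕ β) (ℚ.- fromℕ (p * β⁻)) ⟩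
    F ℚ.* fromℕ β ℚ.* fromℕ α ℚ.+ (ℚ.- fromℕ (p * β⁻)) ℚ.* fromℕ α
      ≡⟨ cong₂ ℚ._+_ first second ⟩
    (fromℕ c ℚ.+ fromℕ u) ℚ.+ ℚ.- fromℕ u
      ≡⟨ ℚ.+-assoc (fromℕ c) (fromℕ u) (ℚ.- fromℕ u) ⟩
    fromℕ c ℚ.+ (fromℕ u ℚ.- fromℕ u)
      ≡⟨ cong (fromℕ c ℚ.+_) (ℚ.+-inverseʳ (fromℕ u)) ⟩
    fromℕ c ℚ.+ ℚ.0ℚ
      ≡⟨ ℚ.+-identityʳ (fromℕ c) ⟩
    fromℕ c ∎)
    where
    open ≡-Reasoning
    n = suc n′
    F = frac s n
    G = frac (p * k) Z
    α = m * n M i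
    α⁻ = prev (suc (m * n) M_) i
    β = Z C k
    β⁻ = Z C⁻ k
    u = p * (α * β⁻)

    -- Adding i α β on both sides avoids the subtraction n - i; rewritten as m n α⁻ β, it completes
    -- the balance equation.
    numerator : n * (c + u) ≡ s * (β * α)
    numerator = +-cancelʳ-≡ (i * α * β) _ _ (begin
      n * (c + u) + i * α * β           ≡⟨ cong (λ v → n * (c + u) + v * β) (M-absorption (m * n) i) ⟨
      n * (c + u) + m * n * α⁻ * β      ≡⟨ collect m n c u α⁻ β ⟩
      n * (c + (u + m * (α⁻ * β)))      ≡⟨ cong (n *_) balance ⟩
      n * (α * β)                       ≡⟨ cong (_* (α * β)) s+i≡n ⟨
      (s + i) * (α * β)                 ≡⟨ expand s i α β ⟩
      s * (β * α) + i * α * β           ∎)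
      where
      collect : ∀ m n c u a b → n * (c + u) + m * n * a * b ≡ n * (c + (u + m * (a * b)))
      collect = solve-∀
      expand : ∀ s i a b → (s + i) * (a * b) ≡ s * (b * a) + i * a * b
      expand = solve-∀

    first : F ℚ.* fromℕ β ℚ.* fromℕ α ≡ fromℕ c ℚ.+ fromℕ u
    first = begin
      F ℚ.* fromℕ β ℚ.* fromℕ α    ≡⟨ ℚ.*-assoc F (fromℕ β) (fromℕ α) ⟩
      F ℚ.* (fromℕ β ℚ.* fromℕ α)  ≡⟨ cong (F ℚ.*_) (fromℕ-* β α) ⟩
      F ℚ.* fromℕ (β * α)          ≡⟨ frac-* s n′ numerator ⟩
      fromℕ (c + u)                ≡⟨ fromℕ-+ c u ⟩
      fromℕ c ℚ.+ fromℕ u          ∎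

    second : (ℚ.- fromℕ (p * β⁻)) ℚ.* fromℕ α ≡ ℚ.- fromℕ u
    second = trans (sym (ℚ.neg-distribˡ-* (fromℕ (p * β⁻)) (fromℕ α)))
      (cong ℚ.-_ (trans (fromℕ-* (p * β⁻) α)
        (cong fromℕ (trans (*-assoc p β⁻ α) (cong (p *_) (*-comm β⁻ α))))))

-- The number of paths for a given class of diagonals

module Theorem (m′ p′ : ℕ) {Allowed : Point → Set} {Ok : ℕ → Set} {φ : ℕ → ℕ}
               (periodic : Periodic (suc m′) (suc p′) Ok φ)
               (classifies : Classifies (suc m′) Allowed Ok) where

  open Counting m′ p′ periodic
  open Periodic periodic

  -- The levels up to m (t + 1) form t + 1 periods with p admissible levels each, and level 1 is
  -- left out.
  φ-start : ∀ t → φ (t + m′ * suc t) ≡ p′ + p * t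
  φ-start zero = trans (cong φ (*-identityʳ m′)) (trans φ-pred (sym (trans (cong (p′ +_) (*-zeroʳ p)) (+-identityʳ p′))))
  φ-start (suc t) = begin
    φ (suc t + m′ * suc (suc t))  ≡⟨ cong φ (shift m′ t) ⟩
    φ (m + (t + m′ * suc t))      ≡⟨ φ-period (t + m′ * suc t) ⟩
    p + φ (t + m′ * suc t)        ≡⟨ cong (p +_) (φ-start t) ⟩
    p + (p′ + p * t)              ≡⟨ unshift p′ t ⟩
    p′ + p * suc t                ∎
    where
    open ≡-Reasoning
    shift : ∀ m′ t → suc t + m′ * suc (suc t) ≡ suc m′ + (t + m′ * suc t)
    shift = solve-∀
    unshift : ∀ p′ t → suc p′ + (p′ + suc p′ * t) ≡ p′ + suc p′ * suc t
    unshift = solve-∀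

  open Evaluation m p

  allowed-paths : ∀ n t a b → 0 < n → 0 < t → t ≤ n → b ≤ a → a ≤ n ∸ t →
    ∃[ k ] HasCardinality (Paths.AllowedPath m n classifies t a b) k ×
      fromℕ k ≡
        (frac (t + a) n ℚ.- frac (p * (a ∸ b)) (p * n ∸ b ∸ 1))
          ℚ.* fromℕ ((p * n ∸ b ∸ 1) C (a ∸ b))
          ℚ.* fromℕ ((m * n + n ∸ t ∸ a ∸ 1) C (n ∸ t ∸ a))
  allowed-paths n@(suc n′) t@(suc t′) a b _ _ t≤n b≤a a≤n∸t =
    -- `suc e` is the starting level m t by computation.
    let e = t′ + m′ * t
        c , card , bal = count (columns e i k b) (slots e i k b) e i k b refl refl
    in c ,
       cardinality-⇔ (path⇔walk (s≤s z≤n) (s≤s z≤n) (sym k+b≡a) height)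
         (cardinality-image (replicate t N ++_) (λ {x} {y} → ++-cancelˡ (replicate t N) x y) card) ,
       trans (count-formula {Z = p * n ∸ b ∸ 1} (t + a) n′ total
               (subst₂ (λ X Z → Count c X Z i k) columns≡ slots≡ bal))
             (cong (λ u → (frac (t + a) n ℚ.- frac (p * k) (p * n ∸ b ∸ 1))
                             ℚ.* fromℕ ((p * n ∸ b ∸ 1) C k) ℚ.* fromℕ ((u ∸ 1) C i)) X+i≡)
    where
    open Paths m n classifies
    open ≡-Reasoning
    k = a ∸ b
    i = n ∸ t ∸ a

    k+b≡a : k + b ≡ a
    k+b≡a = m∸n+n≡m b≤a

    i+a≡ : i + a ≡ n ∸ t
    i+a≡ = m∸n+n≡m a≤n∸t

    total : t + a + i ≡ n
    total = begin
      t + a + i    ≡⟨ +-assoc t a i ⟩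
      t + (a + i)  ≡⟨ cong (t +_) (trans (+-comm a i) i+a≡) ⟩
      t + (n ∸ t)  ≡⟨ m+[n∸m]≡n t≤n ⟩
      n            ∎

    height : t + (i + k + b) ≡ n
    height = begin
      t + (i + k + b)    ≡⟨ cong (t +_) (+-assoc i k b) ⟩
      t + (i + (k + b))  ≡⟨ cong (λ u → t + (i + u)) k+b≡a ⟩
      t + (i + a)        ≡⟨ cong (t +_) i+a≡ ⟩
      t + (n ∸ t)        ≡⟨ m+[n∸m]≡n t≤n ⟩
      n                  ∎

    columns≡ : suc (columns (t′ + m′ * t) i k b) ≡ m * n
    columns≡ = trans (sym (*-distribˡ-+ m t (i + k + b))) (cong (m *_) height)

    slots≡ : slots (t′ + m′ * t) i k b ≡ p * n ∸ b ∸ 1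
    slots≡ = sym (begin
      p * n ∸ b ∸ 1                              ≡⟨ cong (λ u → p * u ∸ b ∸ 1) height ⟨
      p * (t + (i + k + b)) ∸ b ∸ 1              ≡⟨ cong (λ u → u ∸ b ∸ 1) (identity p′ t′ (i + k) b) ⟩
      suc (p′ + p * t′ + p * (i + k) + p′ * b) + b ∸ b ∸ 1
                                                 ≡⟨ cong (_∸ 1) (m+n∸n≡m (suc (p′ + p * t′ + p * (i + k) + p′ * b)) b) ⟩
      p′ + p * t′ + p * (i + k) + p′ * b         ≡⟨ cong (λ u → u + p * (i + k) + p′ * b) (φ-start t′) ⟨
      slots (t′ + m′ * t) i k b                  ∎)
      where
      identity : ∀ p′ t′ j b → suc p′ * (suc t′ + (j + b)) ≡
                 suc (p′ + suc p′ * t′ + suc p′ * j + p′ * b) + b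
      identity = solve-∀

    X+i≡ : m * n + i ≡ m * n + n ∸ t ∸ a
    X+i≡ = begin
      m * n + (n ∸ t ∸ a)  ≡⟨ +-∸-assoc (m * n) a≤n∸t ⟨
      m * n + (n ∸ t) ∸ a  ≡⟨ cong (_∸ a) (+-∸-assoc (m * n) t≤n) ⟨
      m * n + n ∸ t ∸ a    ∎

-- The two classes of diagonals: all, and those ending at multiples of m

all-periodic : ∀ m → Periodic m m (λ _ → ⊤) id
all-periodic m = record
  { ok?      = λ _ → yes tt
  ; φ-ok     = λ _ → refl
  ; φ-¬ok    = λ ¬ok → contradiction tt ¬ok
  ; φ-zero   = refl
  ; φ-pred   = refl
  ; φ-period = λ _ → refl
  }

all-classifies : ∀ m → Classifies m (λ _ → ⊤) (λ _ → ⊤)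
all-classifies m = record { at-corner = λ _ → tt ; above = λ _ → mk⇔ id id }

[r+qm]/m≡q : ∀ {m} q {r} .{{_ : NonZero m}} → r < m → (r + q * m) / m ≡ q
[r+qm]/m≡q {m} q {r} r<m = begin
  (r + q * m) / m         ≡⟨ +-distrib-/-∣ʳ r (n∣m*n q) ⟩
  r / m + q * m / m      ≡⟨ cong₂ _+_ (m<n⇒m/n≡0 r<m) (m*n/n≡m q m) ⟩
  q                        ∎
  where open ≡-Reasoning

-- The quotient e / m is the number of multiples of m among 1, ..., e.
multiples-periodic : ∀ m′ → Periodic (suc m′) 1 (suc m′ ∣_) (_/ suc m′)
multiples-periodic m′ = record
  { ok?      = m ∣?_
  ; φ-ok     = φ-ok
  ; φ-¬ok    = φ-¬ok
  ; φ-zero   = 0/n≡0 m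
  ; φ-pred   = m<n⇒m/n≡0 (n<1+n m′)
  ; φ-period = λ e → trans (+-distrib-/-∣ˡ e (divides 1 (sym (*-identityˡ m)))) (cong (_+ e / m) (n/n≡1 m))
  }
  where
  m = suc m′
  open ≡-Reasoning

  φ-ok : ∀ {e} → m ∣ suc e → suc e / m ≡ suc (e / m)
  φ-ok (divides (suc q) refl) = trans (m*n/n≡m (suc q) m) (cong suc (sym ([r+qm]/m≡q q (n<1+n m′))))

  φ-¬ok : ∀ {e} → ¬ m ∣ suc e → suc e / m ≡ e / m
  φ-¬ok {e} m∤ = begin
    suc e / m                           ≡⟨ cong (_/ m) 1+e≡ ⟩
    (suc (e % m) + (e / m) * m) / m   ≡⟨ [r+qm]/m≡q (e / m) (≤∧≢⇒< (m%n<n e m) 1+r≢m) ⟩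
    e / m                               ∎
    where
    1+e≡ : suc e ≡ suc (e % m) + (e / m) * m
    1+e≡ = cong suc (m≡m%n+[m/n]*n e m)
    1+r≢m : suc (e % m) ≢ m
    1+r≢m 1+r≡m = m∤ (divides (suc (e / m)) (trans 1+e≡ (cong (_+ (e / m) * m) 1+r≡m)))

-- At level e + 2 the numbers x + 1 and e + 1 add up to m y, so m divides both or neither; at level
-- 1, x + 1 is m y itself.
multiples-classify : ∀ m → Classifies m (λ p → m ∣ proj₁ (advance p D)) (m ∣_)
multiples-classify m = record
  { at-corner = λ {x} {y} level → divides y (trans (+-comm 1 x) (trans level (*-comm m y)))
  ; above = λ {x} {y} {e} level →
      let sum = trans (sym (+-suc x (suc e))) level
      in mk⇔ (∣m+n∣m⇒∣n (subst (m ∣_) (sym sum) (m∣m*n y)))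
             (∣m+n∣m⇒∣n (subst (m ∣_) (trans (sym sum) (+-comm (suc x) (suc e))) (m∣m*n y)))
  }

theorem1p4 : (m n t a b : ℕ) → 0 < m → 0 < n → 0 < t → t ≤ n → b ≤ a → a ≤ n ∸ t →
    (∃[ k ] HasCardinality (PositivePath m t n a b) k ×
    fromℕ k ≡
    (frac (t + a) n ℚ.- frac (m * (a ∸ b)) (m * n ∸ b ∸ 1))
    ℚ.* fromℕ ((m * n ∸ b ∸ 1) C (a ∸ b))
    ℚ.* fromℕ ((m * n + n ∸ t ∸ a ∸ 1) C (n ∸ t ∸ a)))
    ×
    (∃[ k ] HasCardinality (DivisiblePositivePath m t n a b) k ×
    fromℕ k ≡
    (frac (t + a) n ℚ.- frac (a ∸ b) (n ∸ b ∸ 1))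
    ℚ.* fromℕ ((n ∸ b ∸ 1) C (a ∸ b))
    ℚ.* fromℕ ((m * n + n ∸ t ∸ a ∸ 1) C (n ∸ t ∸ a)))
theorem1p4 (suc m′) n t a b _ 0<n 0<t t≤n b≤a a≤n∸t =
  (let k , card , eq = Theorem.allowed-paths m′ m′ (all-periodic (suc m′)) (all-classifies (suc m′)) n t a b 0<n 0<t t≤n b≤a a≤n∸t
   in k , cardinality-⇔ (λ w → mk⇔ proj₁ (λ h → h , universal (λ _ → tt) _)) card , eq) ,
  -- Here p = 1, and what remains is to remove this factor from the formula.
  (let k , card , eq = Theorem.allowed-paths m′ 0 (multiples-periodic m′) (multiples-classify (suc m′)) n t a b 0<n 0<t t≤n b≤a a≤n∸t
   in k , card , trans eq (cong₂ (λ d u → (frac (t + a) n ℚ.- frac d (u ∸ b ∸ 1)) ℚ.* fromℕ ((u ∸ b ∸ 1) C (a ∸ b)) ℚ.* fromℕ ((suc m′ * n + n ∸ t ∸ a ∸ 1) C (n ∸ t ∸ a)))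
                      (*-identityˡ (a ∸ b)) (*-identityˡ n)))
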